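{- Let $n\ge 1$ and suppose that $\alpha\in S_n$ has precisely $m\ge 1$ nontrivial cycles, each cycle having the same length $d$ (so $d>1$). If $\alpha$ has at least one fixed point, then $\alpha\in\mathrm{Aut}(n)$ if and only if $n\le 2md$. If $\alpha$ has no fixed points, then $\alpha\in\mathrm{Aut}(n)$ if and only if $d$ is odd or $m$ is even.
   Context: A Latin square of order $n$ is an $n\times n$ array $L=L(i,j)$ with rows, columns and symbols indexed by $[n]=\{1,\dots,n\}$ such that the symbols in every row and in every column are distinct. $S_n$ is the symmetric group on $[n]$. A permutation $\alpha\in S_n$ is an automorphism of $L$ if $\alpha(L(i,j))=L(\alpha(i),\alpha(j))$ for all $i,j\in[n]$. $\mathrm{Aut}(n)$ denotes the set of all $\alpha\in S_n$ that are an automorphism of at least one Latin square of order $n$. A cycle of a permutation is nontrivial if its length is greater than one; fixed points are the cycles of length $1$. -}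

module Defs where

open import Data.Fin using (Fin)
open import Data.Fin.Permutation using (Permutation′; _⟨$⟩ʳ_)
open import Data.Fin.Subset as Subset using (Subset; ∣_∣)
open import Data.Nat using (ℕ; _>_)
open import Data.Nat.GeneralisedArithmetic using (fold)
open import Data.Product using (∃; _×_)
open import Data.Vec using (Vec)
open import Data.Vec.Membership.Propositional as Vec using ()
open import Data.Vec.Relation.Unary.Unique.Propositional using (Unique)
open import Function.Bundles using (_⇔_)
open import Function.Definitions using (Injective)
open import Level using (0ℓ)
open import Relation.Binary.PropositionalEquality using (_≡_)
open import Relation.Unary using (Pred)

record LatinSquare (n : ℕ) : Set where
  field
    entry           : Fin n → Fin n → Fin n
    row-distinct    : ∀ i → Injective _≡_ _≡_ (λ j → entry i j)
    column-distinct : ∀ j → Injective _≡_ _≡_ (λ i → entry i j)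

open LatinSquare public

IsAutomorphism : ∀ {n} → Permutation′ n → LatinSquare n → Set
IsAutomorphism α L =
  ∀ i j → α ⟨$⟩ʳ entry L i j ≡ entry L (α ⟨$⟩ʳ i) (α ⟨$⟩ʳ j)

Aut : ∀ n → Pred (Permutation′ n) 0ℓ
Aut n α = ∃ λ (L : LatinSquare n) → IsAutomorphism α L

-- A cycle is identified with its support, i.e. an orbit of α. Nonnegative
-- iterates of α suffice, since α permutes a finite set.
IsCycle : ∀ {n} → Permutation′ n → Subset n → Set
IsCycle α C = ∃ λ i → ∀ j → j Subset.∈ C ⇔ ∃ λ k → fold i (α ⟨$⟩ʳ_) k ≡ j

cycleLength : ∀ {n} → Subset n → ℕ
cycleLength C = ∣ C ∣

IsNontrivialCycle : ∀ {n} → Permutation′ n → Subset n → Set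
IsNontrivialCycle α C = IsCycle α C × cycleLength C > 1

-- The nontrivial cycles are exactly the entries of a repetition-free vector
-- of length m.
HasPreciselyNontrivialCycles : ∀ {n} → Permutation′ n → ℕ → Set
HasPreciselyNontrivialCycles {n} α m =
  ∃ λ (cs : Vec (Subset n) m) →
    Unique cs × (∀ C → C Vec.∈ cs ⇔ IsNontrivialCycle α C)

HasFixedPoint : ∀ {n} → Permutation′ n → Set
HasFixedPoint α = ∃ λ i → α ⟨$⟩ʳ i ≡ i

{-# OPTIONS --safe #-}

-- Numbering each nontrivial cycle by Fin d conjugates α to the map that fixes
-- Fin f and adds 1 in the second coordinate of Fin m × Fin d.
--
-- With fixed points: the fixed symbols form a subsquare, so f ≤ m d. Conversely
-- α is the m-th power of a permutation with f fixed points and a single cycle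
-- of length N = m d, so it suffices to treat m = 1. There a near-orthomorphism
-- c of ℤ/N gives the array x + c (y − x), from which f broken diagonals are
-- moved to new rows and columns.
--
-- Without fixed points: let (i , x) have label x. Comparing the sum of the labels
-- of (i , 0) · (j , k) over all i, j, k by rows and by columns gives
-- m² (0 + 1 + ⋯ + (d − 1)) ≡ 0 (mod d), which fails for d even and m odd. For d
-- odd the idempotent square 2 x − y on ℤ/d, and for d even a square on two cycles
-- of length d, is multiplied by a square on which α acts trivially.

module Submission where

open import Defs
import Algebra.Properties.AbelianGroup as AbelianGroupProperties
open import Algebra.Bundles using (AbelianGroup)
open import Data.Fin
  using (Fin; _↑ʳ_; _↑ˡ_; cast; combine; punchOut; remQuot; splitAt; suc; toℕ; zero)
open import Data.Fin.Permutation using (Permutation′; _⟨$⟩ʳ_; ↔⇒≡)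
open import Data.Fin.Properties
  using (*↔×; +↔⊎; _≟_; any?; cast-involutive; combine-injective; combine-remQuot; injective⇒≤;
    pigeonhole; punchOut-injective; remQuot-combine; splitAt-↑ʳ; splitAt-↑ˡ; splitAt⁻¹-↑ʳ;
    splitAt⁻¹-↑ˡ; suc-injective; toℕ-cast; toℕ-combine; toℕ-fromℕ<; toℕ-injective; toℕ-↑ˡ;
    toℕ<n)
open import Data.Fin.Subset as Subset using (Subset; inside; outside; ∣_∣)
open import Data.Fin.Subset.Properties using (drop-there; ⊆-antisym)
open import Data.Nat
  using (>-nonZero; NonZero; _*_; _+_; _<_; _∸_; _≤_; _≥_; s<s; suc; s≤s; z<s; zero; ℕ)
open import Data.Nat.DivMod
  using (%-distribˡ-*; %-distribˡ-+; [m+kn]%n≡m%n; _%_; _/_; _mod_; m%n%n≡m%n; m%n*o≡m*o%[n*o];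
    m%n<n; m*n%n≡0; m<n⇒m%n≡m; m≡m%n+[m/n]*n; n%n≡0)
open import Data.Nat.Divisibility using (*-cancelˡ-∣; _∣?_; _∣_; _∤_; divides; m%n≡0⇒n∣m; ∣m+n∣m⇒∣n)
open import Data.Nat.GeneralisedArithmetic using (fold; fold-+)
open import Data.Nat.Primality using (euclidsLemma; prime?)
open import Data.Nat.Properties
  using (*-cancelʳ-≡; *-comm; +-0-commutativeMonoid; +-assoc; +-cancelʳ-≤; +-cancelˡ-<; +-comm;
    +-monoˡ-≤; +-suc; 1+n≰n; <-cmp; <-irrefl; <-≤-trans; <⇒≤; m*n≢0; m*n≢0⇒m≢0; m+[n∸m]≡n;
    m<n⇒0<n∸m; m∸n+n≡m; m∸n≤m; m≤m*n; m≤m+n; n<1+n; ≤-antisym; ≤-pred; ≤-trans)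
open import Data.Nat.Tactic.RingSolver using (solve-∀)
open import Data.Product using (_,_; _×_; map₂; proj₁; proj₂; ∃) renaming (map to map-×)
open import Data.Product.Properties using (,-injectiveʳ)
open import Data.Sum using ([_,_]′; _⊎_; inj₁; inj₂; reduce) renaming (map to map-⊎)
open import Data.Sum.Function.Propositional using (_⊎-↔_)
open import Data.Sum.Properties using (inj₁-injective; inj₂-injective)
open import Data.Vec using (_∷_; here; lookup; tabulate; there)
open import Data.Vec.Membership.Propositional.Properties using (∈-lookup)
open import Data.Vec.Properties using ([]=⇒lookup; lookup⇒[]=; lookup∘tabulate)
open import Data.Vec.Relation.Unary.Any using (here; index)
open import Data.Vec.Relation.Unary.Any.Properties using (lookup-index)
open import Data.Vec.Relation.Unary.Unique.Propositional.Properties using (lookup-injective)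
open import Function using (_∘_; id)
open import Function.Bundles using (Equivalence; Injection; Inverse; _↔_; _⇔_; mk↔ₛ′; mk⇔)
open import Function.Construct.Composition using (_↔-∘_)
open import Function.Construct.Identity using (↔-id)
open import Function.Construct.Symmetry using (↔-sym)
open import Function.Definitions using (Injective)
open import Function.Properties.Inverse using (↔⇒↣)
open import Level using (0ℓ)
open import Relation.Binary.Definitions using (tri<; tri>; tri≈)
open import Relation.Binary.PropositionalEquality
open import Relation.Nullary using (contradiction; does; no; yes; ¬_)
open import Relation.Nullary.Decidable using (dec-true; from-yes)
open import Relation.Unary using (Decidable; Pred; _∈_)
open import Algebra.Properties.CommutativeMonoid.Sum +-0-commutativeMonoid
  using (sum; sum-syntax; sum-cong-≗; sum-permute; ∑-comm; ∑-distrib-+)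
open ≡-Reasoning

private variable
  n m d N : ℕ
  A B : Set

-- Arithmetic modulo N on Fin N

residue : .{{_ : NonZero N}} → ℕ → Fin N
residue k = k mod _

toℕ-residue : .{{_ : NonZero N}} (k : ℕ) → toℕ (residue {N} k) ≡ k % N
toℕ-residue {N} k = toℕ-fromℕ< (m%n<n k N)

residue-cong : .{{_ : NonZero N}} {k l : ℕ} → k % N ≡ l % N → residue {N} k ≡ residue l
residue-cong {k = k} {l} eq =
  toℕ-injective (trans (toℕ-residue k) (trans eq (sym (toℕ-residue l))))

residue-injective : .{{_ : NonZero N}} {k l : ℕ} → residue {N} k ≡ residue l → k % N ≡ l % N
residue-injective {k = k} {l} eq =
  trans (sym (toℕ-residue k)) (trans (cong toℕ eq) (toℕ-residue l))

residue-toℕ : .{{_ : NonZero N}} (x : Fin N) → residue (toℕ x) ≡ x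
residue-toℕ x = toℕ-injective (trans (toℕ-residue (toℕ x)) (m<n⇒m%n≡m (toℕ<n x)))

infixl 6 _⊕_ _⊖_

_⊕_ : .{{_ : NonZero N}} → Fin N → Fin N → Fin N
x ⊕ y = residue (toℕ x + toℕ y)

⊝_ : .{{_ : NonZero N}} → Fin N → Fin N
⊝_ {N} x = residue (N ∸ toℕ x)

_⊖_ : .{{_ : NonZero N}} → Fin N → Fin N → Fin N
x ⊖ y = x ⊕ (⊝ y)

-- `residue` is a homomorphism from ℕ. Together with `residue-toℕ` it reduces identities modulo N to
-- identities between natural numbers.
residue-+ : .{{_ : NonZero N}} (k l : ℕ) → residue {N} (k + l) ≡ residue k ⊕ residue l
residue-+ {N} k l = residue-cong (begin
  (k + l) % N                                ≡⟨ %-distribˡ-+ k l N ⟩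
  (k % N + l % N) % N                        ≡⟨ cong₂ (λ a b → (a + b) % N) (toℕ-residue k) (toℕ-residue l) ⟨
  (toℕ (residue {N} k) + toℕ (residue {N} l)) % N ∎)

⊕-comm : .{{_ : NonZero N}} (x y : Fin N) → x ⊕ y ≡ y ⊕ x
⊕-comm x y = cong residue (+-comm (toℕ x) (toℕ y))

⊕-assoc : .{{_ : NonZero N}} (x y z : Fin N) → x ⊕ y ⊕ z ≡ x ⊕ (y ⊕ z)
⊕-assoc x y z = begin
  residue (toℕ x + toℕ y) ⊕ z                 ≡⟨ cong (x ⊕ y ⊕_) (residue-toℕ z) ⟨
  residue (toℕ x + toℕ y) ⊕ residue (toℕ z)   ≡⟨ residue-+ _ _ ⟨
  residue (toℕ x + toℕ y + toℕ z)             ≡⟨ cong residue (+-assoc (toℕ x) _ _) ⟩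
  residue (toℕ x + (toℕ y + toℕ z))           ≡⟨ residue-+ _ _ ⟩
  residue (toℕ x) ⊕ residue (toℕ y + toℕ z)   ≡⟨ cong (_⊕ (y ⊕ z)) (residue-toℕ x) ⟩
  x ⊕ (y ⊕ z)                                 ∎

⊕-identityˡ : .{{_ : NonZero N}} (x : Fin N) → residue 0 ⊕ x ≡ x
⊕-identityˡ x = begin
  residue 0 ⊕ x               ≡⟨ cong (residue 0 ⊕_) (residue-toℕ x) ⟨
  residue 0 ⊕ residue (toℕ x) ≡⟨ residue-+ 0 (toℕ x) ⟨
  residue (toℕ x)             ≡⟨ residue-toℕ x ⟩
  x                           ∎

⊕-inverseʳ : .{{_ : NonZero N}} (x : Fin N) → x ⊕ (⊝ x) ≡ residue 0
⊕-inverseʳ {N} x = begin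
  x ⊕ (⊝ x)                             ≡⟨ cong (_⊕ (⊝ x)) (residue-toℕ x) ⟨
  residue (toℕ x) ⊕ residue (N ∸ toℕ x) ≡⟨ residue-+ (toℕ x) _ ⟨
  residue (toℕ x + (N ∸ toℕ x))         ≡⟨ cong residue (m+[n∸m]≡n (<⇒≤ (toℕ<n x))) ⟩
  residue N                             ≡⟨ residue-cong (trans (n%n≡0 N) (sym (m<n⇒m%n≡m (>0 x)))) ⟩
  residue 0                             ∎
  where
  >0 : ∀ {N} → Fin N → 0 < N
  >0 {suc _} _ = z<s

ℤ/_ : (N : ℕ) .{{_ : NonZero N}} → AbelianGroup 0ℓ 0ℓ
ℤ/ N = record
  { Carrier = Fin N ; _≈_ = _≡_ ; _∙_ = _⊕_ ; ε = residue 0 ; _⁻¹ = ⊝_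
  ; isAbelianGroup = record
    { isGroup = record
      { isMonoid = record
        { isSemigroup = record
          { isMagma = record { isEquivalence = isEquivalence ; ∙-cong = cong₂ _⊕_ }
          ; assoc = ⊕-assoc }
        ; identity = ⊕-identityˡ , λ x → trans (⊕-comm x _) (⊕-identityˡ x) }
      ; inverse = (λ x → trans (⊕-comm _ x) (⊕-inverseʳ x)) , ⊕-inverseʳ
      ; ⁻¹-cong = cong ⊝_ }
    ; comm = ⊕-comm } }

module _ {N : ℕ} .{{_ : NonZero N}} where
  open AbelianGroupProperties (ℤ/ N) public
    using (⁻¹-injective)
    renaming ( ∙-cancelˡ to ⊕-cancelˡ; ∙-cancelʳ to ⊕-cancelʳ
             ; identityʳ-unique to ⊕-identityʳ-unique; //-rightDividesˡ to [x⊖y]⊕y≡x)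
  open AbelianGroup (ℤ/ N) public
    using () renaming (identityʳ to ⊕-identityʳ; inverseˡ to ⊕-inverseˡ)

-- Latin squares with a prescribed automorphism, and their transport along conjugation

-- The carrier is an arbitrary type, so that squares can be built on sums and products, where the
-- automorphism has a simple form, and carried to `Fin n` by `transfer`.
record EquivariantLatin {A : Set} (a : A → A) : Set where
  infixl 7 _·_
  field
    _·_         : A → A → A
    ·-cancelˡ   : ∀ x {y z} → x · y ≡ x · z → y ≡ z
    ·-cancelʳ   : ∀ x {y z} → y · x ≡ z · x → y ≡ z
    equivariant : ∀ x y → a (x · y) ≡ a x · a y

record Conjugate {A B : Set} (a : A → A) (b : B → B) : Set where
  field
    bijection : A ↔ B
  open Inverse bijection public using (to; from)
    renaming (strictlyInverseˡ to to-from; strictlyInverseʳ to from-to)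
  field
    commute : ∀ x → to (a x) ≡ b (to x)

  to-injective : Injective _≡_ _≡_ to
  to-injective eq = trans (sym (from-to _)) (trans (cong from eq) (from-to _))

  from-injective : Injective _≡_ _≡_ from
  from-injective eq = trans (sym (to-from _)) (trans (cong to eq) (to-from _))

conjugate-sym : {a : A → A} {b : B → B} → Conjugate a b → Conjugate b a
conjugate-sym {a = a} {b} φ = record
  { bijection = ↔-sym bijection
  ; commute   = λ x → to-injective (begin
      to (from (b x))   ≡⟨ to-from (b x) ⟩
      b x               ≡⟨ cong b (to-from x) ⟨
      b (to (from x))   ≡⟨ commute (from x) ⟨
      to (a (from x))   ∎)
  }
  where open Conjugate φ

transfer : {a : A → A} {b : B → B} → Conjugate a b → EquivariantLatin a → EquivariantLatin b
transfer {a = a} {b} φ L = record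
  { _·_         = λ x y → to (from x · from y)
  ; ·-cancelˡ   = λ x eq → from-injective (·-cancelˡ (from x) (to-injective eq))
  ; ·-cancelʳ   = λ x eq → from-injective (·-cancelʳ (from x) (to-injective eq))
  ; equivariant = λ x y → begin
      b (to (from x · from y))         ≡⟨ commute _ ⟨
      to (a (from x · from y))         ≡⟨ cong to (equivariant _ _) ⟩
      to (a (from x) · a (from y))     ≡⟨ cong₂ (λ u v → to (u · v)) (sym-commute x) (sym-commute y) ⟨
      to (from (b x) · from (b y))     ∎
  }
  where
  open Conjugate φ
  open EquivariantLatin L
  sym-commute = Conjugate.commute (conjugate-sym φ)

∈Aut⇒equivariantLatin : (α : Permutation′ n) → α ∈ Aut n → EquivariantLatin (α ⟨$⟩ʳ_)
∈Aut⇒equivariantLatin α (L , auto) = record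
  { _·_         = entry L
  ; ·-cancelˡ   = λ x → row-distinct L x
  ; ·-cancelʳ   = λ x → column-distinct L x
  ; equivariant = auto
  }

equivariantLatin⇒∈Aut : (α : Permutation′ n) → EquivariantLatin (α ⟨$⟩ʳ_) → α ∈ Aut n
equivariantLatin⇒∈Aut α L =
  record { entry = _·_ ; row-distinct = λ x → ·-cancelˡ x ; column-distinct = λ x → ·-cancelʳ x }
  , equivariant
  where open EquivariantLatin L

-- The direct product. A first factor with `a = id` multiplies the number of cycles of `b` and keeps
-- their lengths.
_⊗_ : {a : A → A} {b : B → B} → EquivariantLatin a → EquivariantLatin b → EquivariantLatin (map-× a b)
L ⊗ M = record
  { _·_         = λ (x , y) (x′ , y′) → x L.· x′ , y M.· y′
  ; ·-cancelˡ   = λ (x , y) eq →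
      cong₂ _,_ (L.·-cancelˡ x (cong proj₁ eq)) (M.·-cancelˡ y (cong proj₂ eq))
  ; ·-cancelʳ   = λ (x , y) eq →
      cong₂ _,_ (L.·-cancelʳ x (cong proj₁ eq)) (M.·-cancelʳ y (cong proj₂ eq))
  ; equivariant = λ (x , y) (x′ , y′) → cong₂ _,_ (L.equivariant x x′) (M.equivariant y y′)
  }
  where
  module L = EquivariantLatin L
  module M = EquivariantLatin M

cyclicSquare : (N : ℕ) .{{_ : NonZero N}} → EquivariantLatin {Fin N} id
cyclicSquare N = record
  { _·_         = _⊕_
  ; ·-cancelˡ   = λ x → ⊕-cancelˡ x _ _
  ; ·-cancelʳ   = λ x → ⊕-cancelʳ x _ _
  ; equivariant = λ _ _ → refl
  }

-- Enumerating the elements of a subset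

member : (C : Subset n) → Fin ∣ C ∣ → Fin n
member (inside  ∷ C) zero    = zero
member (inside  ∷ C) (suc i) = suc (member C i)
member (outside ∷ C) i       = suc (member C i)

member-∈ : (C : Subset n) (i : Fin ∣ C ∣) → member C i Subset.∈ C
member-∈ (inside  ∷ C) zero    = here
member-∈ (inside  ∷ C) (suc i) = there (member-∈ C i)
member-∈ (outside ∷ C) i       = there (member-∈ C i)

member-injective : (C : Subset n) → Injective _≡_ _≡_ (member C)
member-injective (inside  ∷ C) {zero}  {zero}  eq = refl
member-injective (inside  ∷ C) {suc i} {suc j} eq = cong suc (member-injective C (suc-injective eq))
member-injective (outside ∷ C)                 eq = member-injective C (suc-injective eq)

member-surjective : (C : Subset n) {x : Fin n} → x Subset.∈ C → ∃ λ i → member C i ≡ x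
member-surjective (inside  ∷ C) {zero}  _   = zero , refl
member-surjective (inside  ∷ C) {suc x} x∈C =
  let i , eq = member-surjective C (drop-there x∈C) in suc i , cong suc eq
member-surjective (outside ∷ C) {suc x} x∈C =
  let i , eq = member-surjective C (drop-there x∈C) in i , cong suc eq

module _ {ℓ} {P : Pred (Fin n) ℓ} (P? : Decidable P) where

  comprehension : Subset n
  comprehension = tabulate (does ∘ P?)

  ∈-comprehension⁺ : ∀ {x} → P x → x Subset.∈ comprehension
  ∈-comprehension⁺ {x} Px =
    lookup⇒[]= x _ (trans (lookup∘tabulate _ x) (dec-true (P? x) Px))

  ∈-comprehension⁻ : ∀ {x} → x Subset.∈ comprehension → P x
  ∈-comprehension⁻ {x} x∈ with P? x | trans (sym (lookup∘tabulate (does ∘ P?) x)) ([]=⇒lookup x∈)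
  ... | yes Px | _ = Px

-- Orbits of a permutation

module _ (α : Permutation′ n) where

  private
    infixr 8 α^_
    α^_ : ℕ → Fin n → Fin n
    (α^ k) x = fold x (α ⟨$⟩ʳ_) k

  ⟨$⟩ʳ-injective : Injective _≡_ _≡_ (α ⟨$⟩ʳ_)
  ⟨$⟩ʳ-injective = Injection.injective (↔⇒↣ α)

  fold-injective : ∀ k {x y} → (α^ k) x ≡ (α^ k) y → x ≡ y
  fold-injective zero    eq = eq
  fold-injective (suc k) eq = fold-injective k (⟨$⟩ʳ-injective eq)

  fold-∸ : ∀ {x a b} → a ≤ b → (α^ a) x ≡ (α^ b) x → (α^ (b ∸ a)) x ≡ x
  fold-∸ {x} {a} {b} a≤b eq = fold-injective a (begin
    (α^ a) ((α^ (b ∸ a)) x) ≡⟨ fold-+ x _ a ⟨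
    (α^ (a + (b ∸ a))) x    ≡⟨ cong (λ k → (α^ k) x) (m+[n∸m]≡n a≤b) ⟩
    (α^ b) x                ≡⟨ eq ⟨
    (α^ a) x                ∎)

  fold-periodic : ∀ {x p} → (α^ p) x ≡ x → ∀ q → (α^ (q * p)) x ≡ x
  fold-periodic         eq zero    = refl
  fold-periodic {x} {p} eq (suc q) = begin
    (α^ (p + q * p)) x       ≡⟨ fold-+ x _ p ⟩
    (α^ p) ((α^ (q * p)) x)  ≡⟨ cong (α^ p) (fold-periodic eq q) ⟩
    (α^ p) x                 ≡⟨ eq ⟩
    x                        ∎

  fold-% : ∀ {x p} .{{_ : NonZero p}} → (α^ p) x ≡ x → ∀ k → (α^ (k % p)) x ≡ (α^ k) x
  fold-% {x} {p} eq k = begin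
    (α^ (k % p)) x                        ≡⟨ cong (α^ (k % p)) (fold-periodic eq (k / p)) ⟨
    (α^ (k % p)) ((α^ ((k / p) * p)) x)   ≡⟨ fold-+ x _ (k % p) ⟨
    (α^ (k % p + (k / p) * p)) x          ≡⟨ cong (λ l → (α^ l) x) (m≡m%n+[m/n]*n k p) ⟨
    (α^ k) x                              ∎

  -- Two of the exponents 0, ..., N share a value of `f`, and their difference is a period. As `f`
  -- serve the iterates themselves, or their positions within an orbit; the latter sharpens the
  -- bound from n to the size of the orbit.
  period-≤ : ∀ {N} x (f : ℕ → Fin N) → (∀ {k l} → f k ≡ f l → (α^ k) x ≡ (α^ l) x) →
             ∃ λ p → 0 < p × p ≤ N × (α^ p) x ≡ x
  period-≤ {N} x f f-inj =
    let i , j , i<j , eq = pigeonhole (n<1+n N) (f ∘ toℕ)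
    in  toℕ j ∸ toℕ i , m<n⇒0<n∸m i<j ,
        ≤-trans (m∸n≤m (toℕ j) (toℕ i)) (≤-pred (toℕ<n j)) , fold-∸ (<⇒≤ i<j) (f-inj eq)

  IsOrbitOf : Fin n → Pred (Subset n) _
  IsOrbitOf x C = ∀ y → y Subset.∈ C ⇔ (∃ λ k → (α^ k) x ≡ y)

  module Orbit {x : Fin n} {C : Subset n} (orbit : IsOrbitOf x C) where

    -- Every member of `C` is an iterate of `x`, determined by its exponent modulo p; this injects
    -- `C` into the residues modulo p.
    ∣C∣≤period : ∀ {p} → 0 < p → (α^ p) x ≡ x → ∣ C ∣ ≤ p
    ∣C∣≤period {p} 0<p eq = injective⇒≤ {f = residue ∘ proj₁ ∘ exponent} λ {i} {j} eq′ →
      member-injective C (begin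
        member C i                       ≡⟨ proj₂ (exponent i) ⟨
        (α^ proj₁ (exponent i)) x        ≡⟨ fold-% eq _ ⟨
        (α^ (proj₁ (exponent i) % p)) x  ≡⟨ cong (λ k → (α^ k) x) (residue-injective eq′) ⟩
        (α^ (proj₁ (exponent j) % p)) x  ≡⟨ fold-% eq _ ⟩
        (α^ proj₁ (exponent j)) x        ≡⟨ proj₂ (exponent j) ⟩
        member C j                       ∎)
      where
      instance
        p-nonZero = >-nonZero 0<p
      exponent : ∀ i → ∃ λ k → (α^ k) x ≡ member C i
      exponent i = Equivalence.to (orbit _) (member-∈ C i)

    position : ∀ k → ∃ λ i → member C i ≡ (α^ k) x
    position k = member-surjective C (Equivalence.from (orbit _) (k , refl))

    -- Counting positions in `C` yields a positive period of at most `∣ C ∣`, and by `∣C∣≤period` no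
    -- positive period is smaller.
    fold-∣C∣ : (α^ ∣ C ∣) x ≡ x
    fold-∣C∣ =
      let p , 0<p , p≤ , eq = period-≤ x (proj₁ ∘ position) λ {k} {l} eq →
            trans (sym (proj₂ (position k))) (trans (cong (member C) eq) (proj₂ (position l)))
      in  subst (λ q → (α^ q) x ≡ x) (≤-antisym p≤ (∣C∣≤period 0<p eq)) eq

    private
      -- Otherwise l - k would be a positive period below `∣ C ∣`.
      fold-<-≢ : ∀ {k l} → k < l → l < ∣ C ∣ → (α^ k) x ≢ (α^ l) x
      fold-<-≢ {k} {l} k<l l<∣C∣ eq = <-irrefl refl (<-≤-trans l<∣C∣
        (≤-trans (∣C∣≤period (m<n⇒0<n∸m k<l) (fold-∸ (<⇒≤ k<l) eq)) (m∸n≤m l k)))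

    fold-injective-< : ∀ {k l} → k < ∣ C ∣ → l < ∣ C ∣ → (α^ k) x ≡ (α^ l) x → k ≡ l
    fold-injective-< {k} {l} k< l< eq with <-cmp k l
    ... | tri< k<l _ _ = contradiction eq (fold-<-≢ k<l l<)
    ... | tri≈ _ k≡l _ = k≡l
    ... | tri> _ _ l<k = contradiction (sym eq) (fold-<-≢ l<k k<)

    nontrivial : α ⟨$⟩ʳ x ≢ x → 1 < ∣ C ∣
    -- Size 0 is impossible because `position 0` places `x` in `C`; for size 1, `fold-∣C∣` says that
    -- `x` is fixed.
    nontrivial αx≢x with ∣ C ∣ | fold-∣C∣ | proj₁ (position 0)
    ... | suc zero    | αx≡x | _ = contradiction αx≡x αx≢x
    ... | suc (suc _) | _    | _ = s<s z<s

  -- Exponents below a period p reach the whole orbit, so membership is decided by a finite search.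
  orbitOf : ∀ x → ∃ (IsOrbitOf x)
  orbitOf x =
    let p , 0<p , _ , eq = period-≤ x (λ k → (α^ k) x) id
        instance
          p-nonZero = >-nonZero 0<p
        P? = λ y → any? {p} λ k → (α^ toℕ k) x ≟ y
    in  comprehension P? , λ y → mk⇔
          (λ y∈ → let k , eq′ = ∈-comprehension⁻ P? y∈ in toℕ k , eq′)
          (λ (k , eq′) → ∈-comprehension⁺ P?
            (residue k , trans (cong (λ l → (α^ l) x) (toℕ-residue k)) (trans (fold-% eq k) eq′)))

-- Conjugating the permutation to a shift

shift : ∀ f m d .{{_ : NonZero d}} → Fin f ⊎ Fin m × Fin d → Fin f ⊎ Fin m × Fin d
shift f m d = map-⊎ id (map₂ (_⊕ residue 1))

module _ {m d} .{{_ : NonZero d}} (1<d : 1 < d) (α : Permutation′ n)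
  (cycles : HasPreciselyNontrivialCycles α m)
  (length≡d : ∀ C → IsNontrivialCycle α C → cycleLength C ≡ d) where

  private
    cs = proj₁ cycles

    isNontrivial : ∀ i → IsNontrivialCycle α (lookup cs i)
    isNontrivial i = Equivalence.to (proj₂ (proj₂ cycles) _) (∈-lookup i cs)

    base : Fin m → Fin n
    base i = proj₁ (proj₁ (isNontrivial i))

    base-orbit : ∀ i → IsOrbitOf α (base i) (lookup cs i)
    base-orbit i = proj₂ (proj₁ (isNontrivial i))

    length : ∀ i → ∣ lookup cs i ∣ ≡ d
    length i = length≡d _ (isNontrivial i)

    module Base i = Orbit α (base-orbit i)

    point : Fin m → ℕ → Fin n
    point i k = fold (base i) (α ⟨$⟩ʳ_) k

    point-d : ∀ i → point i d ≡ base i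
    point-d i = subst (λ q → point i q ≡ base i) (length i) (Base.fold-∣C∣ i)

    point-% : ∀ i k → point i (k % d) ≡ point i k
    point-% i = fold-% α (point-d i)

    point-injectiveʳ : ∀ i {k l} → point i k ≡ point i l → k % d ≡ l % d
    point-injectiveʳ i {k} {l} eq = Base.fold-injective-< i (<∣C∣ k) (<∣C∣ l)
      (trans (point-% i k) (trans eq (sym (point-% i l))))
      where
      <∣C∣ : ∀ k → k % d < ∣ lookup cs i ∣
      <∣C∣ k = subst (k % d <_) (sym (length i)) (m%n<n k d)

    shared⇒⊆ : ∀ {i j k l} → point i k ≡ point j l → lookup cs i Subset.⊆ lookup cs j
    shared⇒⊆ {i} {j} {k} {l} eq {x} x∈ =
      let q , eq′ = Equivalence.to (base-orbit i x) x∈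
          -- The exponents are natural numbers, so the way back from `point i k` to `base i` is
          -- completed forwards: `k * d` is a multiple of the cycle length that is at least k. A
          -- further q steps lead to x.
          r = q + (k * d ∸ k)
      in Equivalence.from (base-orbit j x) (r + l , (begin
        point j (r + l)                           ≡⟨ fold-+ (base j) _ r ⟩
        fold (point j l) (α ⟨$⟩ʳ_) r              ≡⟨ cong (λ y → fold y (α ⟨$⟩ʳ_) r) eq ⟨
        fold (point i k) (α ⟨$⟩ʳ_) r              ≡⟨ fold-+ (base i) _ r ⟨
        point i (r + k)                           ≡⟨ cong (point i) (arith q k) ⟩
        point i (q + k * d)                       ≡⟨ fold-+ (base i) _ q ⟩
        fold (point i (k * d)) (α ⟨$⟩ʳ_) q
          ≡⟨ cong (λ y → fold y (α ⟨$⟩ʳ_) q) (fold-periodic α (point-d i) k) ⟩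
        point i q                                 ≡⟨ eq′ ⟩
        x                                         ∎))
      where
      arith : ∀ q k → q + (k * d ∸ k) + k ≡ q + k * d
      arith q k = trans (+-assoc q _ k)
        (cong (q +_) (m∸n+n≡m (m≤m*n k d)))

    -- Cycles that meet contain one another, and the entries of `cs` are pairwise distinct.
    point-injectiveˡ : ∀ {i j k l} → point i k ≡ point j l → i ≡ j
    point-injectiveˡ {i} {j} {k} {l} eq = lookup-injective (proj₁ (proj₂ cycles)) i j
      (⊆-antisym (shared⇒⊆ {i} {j} {k} {l} eq) (shared⇒⊆ {j} {i} {l} {k} (sym eq)))

    -- Cancelling the k-th power of α moves the equation to the base point, where it makes 1 and 0
    -- agree modulo d.
    point-moved : ∀ i k → α ⟨$⟩ʳ (point i k) ≢ point i k
    point-moved i k eq with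
      trans (sym (m<n⇒m%n≡m 1<d)) (point-injectiveʳ i {1} {0} (fold-injective α k (begin
        fold (point i 1) (α ⟨$⟩ʳ_) k ≡⟨ fold-+ (base i) _ k ⟨
        point i (k + 1)              ≡⟨ cong (point i) (+-comm k 1) ⟩
        point i (suc k)              ≡⟨ eq ⟩
        point i k                    ∎)))
    ... | 1≡0%d = contradiction (trans 1≡0%d (m<n⇒m%n≡m (<⇒≤ 1<d))) λ ()

    -- The orbit of a moved point is a nontrivial cycle, hence an entry of `cs`.
    moved⇒point : ∀ {x} → α ⟨$⟩ʳ x ≢ x → ∃ λ i → ∃ λ k → point i k ≡ x
    moved⇒point {x} αx≢x =
      let C , orbit = orbitOf α x
          C∈cs = Equivalence.from (proj₂ (proj₂ cycles) C)
                   ((x , orbit) , Orbit.nontrivial α orbit αx≢x)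
          i = index C∈cs
          x∈ = subst (x Subset.∈_) (lookup-index C∈cs) (Equivalence.from (orbit x) (0 , refl))
      in  i , Equivalence.to (base-orbit i x) x∈

    fixed : Subset n
    fixed = comprehension (λ x → α ⟨$⟩ʳ x ≟ x)

    f : ℕ
    f = ∣ fixed ∣

    member-fixed : ∀ a → α ⟨$⟩ʳ (member fixed a) ≡ member fixed a
    member-fixed a = ∈-comprehension⁻ (λ x → α ⟨$⟩ʳ x ≟ x) (member-∈ fixed a)

    from : Fin f ⊎ Fin m × Fin d → Fin n
    from (inj₁ a)       = member fixed a
    from (inj₂ (i , k)) = point i (toℕ k)

    from-injective : Injective _≡_ _≡_ from
    from-injective {inj₁ a} {inj₁ b} eq = cong inj₁ (member-injective fixed eq)
    from-injective {inj₁ a} {inj₂ (i , k)} eq =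
      contradiction (subst (λ x → α ⟨$⟩ʳ x ≡ x) eq (member-fixed a)) (point-moved i (toℕ k))
    from-injective {inj₂ (i , k)} {inj₁ a} eq =
      contradiction (subst (λ x → α ⟨$⟩ʳ x ≡ x) (sym eq) (member-fixed a)) (point-moved i (toℕ k))
    from-injective {inj₂ (i , k)} {inj₂ (j , l)} eq
      with refl ← point-injectiveˡ {i} {j} {toℕ k} {toℕ l} eq
      = cong (λ z → inj₂ (i , z)) (trans (sym (residue-toℕ k))
          (trans (residue-cong (point-injectiveʳ i eq)) (residue-toℕ l)))

    from-surjective : ∀ x → ∃ λ s → from s ≡ x
    from-surjective x with α ⟨$⟩ʳ x ≟ x
    ... | yes αx≡x = let a , eq = member-surjective fixed (∈-comprehension⁺ (λ x → α ⟨$⟩ʳ x ≟ x) αx≡x)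
                     in  inj₁ a , eq
    ... | no  αx≢x = let i , k , eq = moved⇒point αx≢x
                     in  inj₂ (i , residue k)
                         , trans (cong (point i) (toℕ-residue k)) (trans (point-% i k) eq)

    from-shift : ∀ s → from (shift f m d s) ≡ α ⟨$⟩ʳ (from s)
    from-shift (inj₁ a)       = sym (member-fixed a)
    from-shift (inj₂ (i , k)) = begin
      point i (toℕ (k ⊕ residue 1))              ≡⟨ cong (λ z → point i (toℕ (z ⊕ residue 1))) (residue-toℕ k) ⟨
      point i (toℕ (residue (toℕ k) ⊕ residue 1)) ≡⟨ cong (point i ∘ toℕ) (residue-+ (toℕ k) 1) ⟨
      point i (toℕ (residue {d} (toℕ k + 1)))    ≡⟨ cong (point i) (toℕ-residue (toℕ k + 1)) ⟩
      point i ((toℕ k + 1) % d)                  ≡⟨ point-% i (toℕ k + 1) ⟩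
      point i (toℕ k + 1)                        ≡⟨ cong (point i) (+-comm (toℕ k) 1) ⟩
      point i (suc (toℕ k))                      ∎

  decomposition : ∃ λ f → Conjugate (shift f m d) (α ⟨$⟩ʳ_)
  decomposition = f , record
    { bijection = mk↔ₛ′ from (proj₁ ∘ from-surjective) (proj₂ ∘ from-surjective)
        (λ s → from-injective (proj₂ (from-surjective (from s))))
    ; commute   = from-shift
    }

-- Cancellation, parity and halving modulo N

map-⊎-injective : {f : A → A} → Injective _≡_ _≡_ f → Injective _≡_ _≡_ (map-⊎ {A = B} id f)
map-⊎-injective f-inj {inj₁ _} {inj₁ _} eq = cong inj₁ (inj₁-injective eq)
map-⊎-injective f-inj {inj₂ _} {inj₂ _} eq = cong inj₂ (f-inj (inj₂-injective eq))

⊖-cancelˡ : .{{_ : NonZero N}} (x : Fin N) {y z : Fin N} → x ⊖ y ≡ x ⊖ z → y ≡ z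
⊖-cancelˡ x eq = ⁻¹-injective (⊕-cancelˡ x _ _ eq)

⊖-cancelʳ : .{{_ : NonZero N}} (x : Fin N) {y z : Fin N} → y ⊖ x ≡ z ⊖ x → y ≡ z
⊖-cancelʳ x = ⊕-cancelʳ (⊝ x) _ _

⊕-swapʳ : .{{_ : NonZero N}} (x y z : Fin N) → x ⊕ y ⊕ z ≡ x ⊕ z ⊕ y
⊕-swapʳ x y z = trans (⊕-assoc x y z) (trans (cong (x ⊕_) (⊕-comm y z)) (sym (⊕-assoc x z y)))

[x⊕g]⊖[y⊕g] : .{{_ : NonZero N}} (x y g : Fin N) → (x ⊕ g) ⊖ (y ⊕ g) ≡ x ⊖ y
[x⊕g]⊖[y⊕g] x y g = ⊕-cancelʳ (y ⊕ g) _ _ (begin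
  (x ⊕ g) ⊖ (y ⊕ g) ⊕ (y ⊕ g) ≡⟨ [x⊖y]⊕y≡x (y ⊕ g) (x ⊕ g) ⟩
  x ⊕ g                       ≡⟨ cong (_⊕ g) ([x⊖y]⊕y≡x y x) ⟨
  x ⊖ y ⊕ y ⊕ g               ≡⟨ ⊕-assoc (x ⊖ y) y g ⟩
  x ⊖ y ⊕ (y ⊕ g)             ∎)

even⊎odd : ∀ N → (∃ λ h → N ≡ h * 2) ⊎ (∃ λ h → N ≡ suc (h * 2))
even⊎odd N with N % 2 in eq | m%n<n N 2 | m≡m%n+[m/n]*n N 2
... | 0 | _ | N≡ = inj₁ (N / 2 , N≡)
... | 1 | _ | N≡ = inj₂ (N / 2 , N≡)
... | suc (suc _) | s<s (s<s ()) | _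

-- Half of an element is its multiple by (N + 1) / 2.
x⊕x-injective : ∀ h {x y : Fin (suc (h * 2))} → x ⊕ x ≡ y ⊕ y → x ≡ y
x⊕x-injective h {x} {y} eq = begin
  x                 ≡⟨ halve x ⟩
  half (x ⊕ x)      ≡⟨ cong half eq ⟩
  half (y ⊕ y)      ≡⟨ halve y ⟨
  y                 ∎
  where
  M = suc (h * 2)

  half : Fin M → Fin M
  half z = residue (toℕ z * suc h)

  halve : ∀ z → z ≡ half (z ⊕ z)
  halve z = trans (sym (residue-toℕ z)) (residue-cong {k = toℕ z} {toℕ (z ⊕ z) * suc h} (begin
    toℕ z % M                                     ≡⟨ [m+kn]%n≡m%n (toℕ z) (toℕ z) M ⟨
    (toℕ z + toℕ z * M) % M                       ≡⟨ cong (_% M) (arith (toℕ z) h) ⟩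
    ((toℕ z + toℕ z) * suc h) % M                 ≡⟨ %-distribˡ-* (toℕ z + toℕ z) (suc h) M ⟩
    ((toℕ z + toℕ z) % M * (suc h % M)) % M       ≡⟨ cong (λ w → (w * (suc h % M)) % M) (m%n%n≡m%n (toℕ z + toℕ z) M) ⟨
    ((toℕ z + toℕ z) % M % M * (suc h % M)) % M   ≡⟨ %-distribˡ-* ((toℕ z + toℕ z) % M) (suc h) M ⟨
    ((toℕ z + toℕ z) % M * suc h) % M             ≡⟨ cong (λ w → (w * suc h) % M) (toℕ-residue {M} (toℕ z + toℕ z)) ⟨
    (toℕ (z ⊕ z) * suc h) % M                     ∎))
    where
    arith : ∀ z h → z + z * suc (h * 2) ≡ (z + z) * suc h
    arith = solve-∀

-- Near-orthomorphisms of cyclic groups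

module _ (h : ℕ) where

  -- The number h p + r, so that `unglue` is division by h with remainder. The cast produces the
  -- form `h * 2` in which `even⊎odd` presents even numbers.
  glue : Fin 2 × Fin h → Fin (h * 2)
  glue (p , r) = cast (*-comm 2 h) (combine p r)

  unglue : Fin (h * 2) → Fin 2 × Fin h
  unglue = remQuot h ∘ cast (*-comm h 2)

  glue-unglue : ∀ δ → glue (unglue δ) ≡ δ
  glue-unglue δ = trans (cong (cast _) (combine-remQuot {2} h _)) (cast-involutive (*-comm 2 h) (*-comm h 2) δ)

  unglue-glue : ∀ s → unglue (glue s) ≡ s
  unglue-glue (p , r) = trans (cong (remQuot h) (cast-involutive (*-comm h 2) (*-comm 2 h) (combine p r)))
    (remQuot-combine p r)

  toℕ-glue : ∀ p r → toℕ (glue (p , r)) ≡ h * toℕ p + toℕ r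
  toℕ-glue p r = trans (toℕ-cast _ (combine p r)) (toℕ-combine p r)

  glue-injective : Injective _≡_ _≡_ glue
  glue-injective eq = trans (sym (unglue-glue _)) (trans (cong unglue eq) (unglue-glue _))

  unglue-injective : Injective _≡_ _≡_ unglue
  unglue-injective eq = trans (sym (glue-unglue _)) (trans (cong glue eq) (glue-unglue _))

-- The last difference is exempt: on a cyclic group of even order there is no
-- complete mapping.
record NearOrthomorphism (N : ℕ) .{{_ : NonZero N}} : Set where
  field
    b c         : Fin N → Fin N
    b-injective : Injective _≡_ _≡_ b
    c-injective : Injective _≡_ _≡_ c
    c≡b⊕id      : ∀ δ → suc (toℕ δ) < N → c δ ≡ b δ ⊕ δ

oddNearOrthomorphism : ∀ h → NearOrthomorphism (suc (h * 2))
oddNearOrthomorphism h = record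
  { b = id
  ; c = λ δ → δ ⊕ δ
  ; b-injective = id
  ; c-injective = x⊕x-injective h
  ; c≡b⊕id = λ _ _ → refl
  }

-- For δ = h p + r with p < 2 and r < h, take b δ = h p + (r + p mod h) and
-- c δ = 2 r + p.
evenNearOrthomorphism : ∀ h .{{_ : NonZero h}} .{{_ : NonZero (h * 2)}} → NearOrthomorphism (h * 2)
evenNearOrthomorphism h = record
  { b = b ∘ unglue h
  ; c = c ∘ unglue h
  ; b-injective = λ eq → unglue-injective h (b-injective eq)
  ; c-injective = λ eq → unglue-injective h (c-injective eq)
  ; c≡b⊕id = λ δ <N → trans (c≡b⊕glue (unglue h δ) (subst (λ z → suc (toℕ z) < h * 2) (sym (glue-unglue h δ)) <N))
                            (cong (b (unglue h δ) ⊕_) (glue-unglue h δ))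
  }
  where
  b c : Fin 2 × Fin h → Fin (h * 2)
  b (p , r) = glue h (p , r ⊕ residue (toℕ p))
  c (p , r) = combine r p

  b-injective : Injective _≡_ _≡_ b
  b-injective {p , r} {q , s} eq with glue-injective h {p , r ⊕ residue (toℕ p)} {q , s ⊕ residue (toℕ q)} eq
  ... | eq′ with refl ← cong proj₁ eq′ = cong (p ,_) (⊕-cancelʳ (residue (toℕ p)) _ _ (cong proj₂ eq′))

  c-injective : Injective _≡_ _≡_ c
  c-injective {p , r} {q , s} eq = let r≡s , p≡q = combine-injective r p s q eq in cong₂ _,_ p≡q r≡s

  -- The sum r + p wraps around modulo h only for p = 1 and r = h - 1, which is the exempt
  -- difference δ = 2 h - 1.
  toℕ-r⊕p : ∀ p r → suc (toℕ (glue h (p , r))) < h * 2 → toℕ (r ⊕ residue (toℕ p)) ≡ toℕ r + toℕ p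
  toℕ-r⊕p p r <N = begin
    toℕ (r ⊕ residue (toℕ p))                   ≡⟨ cong (λ z → toℕ (z ⊕ residue (toℕ p))) (residue-toℕ r) ⟨
    toℕ (residue (toℕ r) ⊕ residue {h} (toℕ p)) ≡⟨ cong toℕ (residue-+ {h} (toℕ r) (toℕ p)) ⟨
    toℕ (residue {h} (toℕ r + toℕ p))           ≡⟨ toℕ-residue {h} (toℕ r + toℕ p) ⟩
    (toℕ r + toℕ p) % h                         ≡⟨ m<n⇒m%n≡m (r+p<h p <N) ⟩
    toℕ r + toℕ p                               ∎
    where
    r+p<h : ∀ p → suc (toℕ (glue h (p , r))) < h * 2 → toℕ r + toℕ p < h
    r+p<h zero       _  = subst (_< h) (+-comm 0 (toℕ r)) (toℕ<n r)
    r+p<h (suc zero) <N = +-cancelˡ-< h _ _ (subst₂ _<_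
      (trans (cong suc (toℕ-glue h (suc zero) r)) (arith h (toℕ r))) (arith′ h) <N)
      where
      arith : ∀ h r → suc (h * 1 + r) ≡ h + (r + 1)
      arith = solve-∀
      arith′ : ∀ h → h * 2 ≡ h + h
      arith′ = solve-∀

  -- Without wrap-around, b δ + δ = (h p + r + p) + (h p + r) = 2 r + p + 2 h p, and the last term
  -- vanishes modulo 2 h.
  c≡b⊕glue : ∀ s → suc (toℕ (glue h s)) < h * 2 → c s ≡ b s ⊕ glue h s
  c≡b⊕glue (p , r) <N = trans (sym (residue-toℕ (combine r p))) (residue-cong (begin
    toℕ (combine r p) % M                            ≡⟨ cong (_% M) (toℕ-combine r p) ⟩
    (2 * toℕ r + toℕ p) % M                          ≡⟨ [m+kn]%n≡m%n (2 * toℕ r + toℕ p) (toℕ p) M ⟨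
    (2 * toℕ r + toℕ p + toℕ p * M) % M              ≡⟨ cong (_% M) (arith h (toℕ r) (toℕ p)) ⟩
    ((h * toℕ p + (toℕ r + toℕ p)) + (h * toℕ p + toℕ r)) % M
      ≡⟨ cong (λ z → ((h * toℕ p + z) + (h * toℕ p + toℕ r)) % M) (toℕ-r⊕p p r <N) ⟨
    ((h * toℕ p + toℕ (r ⊕ residue (toℕ p))) + (h * toℕ p + toℕ r)) % M
      ≡⟨ cong₂ (λ u v → (u + v) % M) (toℕ-glue h p (r ⊕ residue (toℕ p))) (toℕ-glue h p r) ⟨
    (toℕ (b (p , r)) + toℕ (glue h (p , r))) % M     ∎))
    where
    M = h * 2
    arith : ∀ h r p → 2 * r + p + p * (h * 2) ≡ (h * p + (r + p)) + (h * p + r)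
    arith = solve-∀

nearOrthomorphism : ∀ N .{{_ : NonZero N}} → NearOrthomorphism N
nearOrthomorphism N with even⊎odd N
... | inj₁ (suc h , refl) = evenNearOrthomorphism (suc h)
... | inj₂ (h     , refl) = oddNearOrthomorphism h

-- Existence with fixed points

-- The square (x , y) ↦ x ⊕ c (y ⊖ x) is prolonged: the symbols on its last f
-- broken diagonals move to new rows and columns, replaced by fixed points.
module Prolongation (e f : ℕ) .{{_ : NonZero f}} .{{_ : NonZero (e + f)}}
  (θ : NearOrthomorphism (e + f)) where
  open NearOrthomorphism θ

  -- The involution that swaps the a-th fixed point with the difference e + a, one of the last f,
  -- and leaves the differences below e alone. Composing a line with it gives the moved diagonal a
  -- fixed point and puts the displaced symbol in the new line.
  exchange : Fin f ⊎ Fin (e + f) → Fin f ⊎ Fin (e + f)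
  exchange (inj₁ a) = inj₂ (e ↑ʳ a)
  exchange (inj₂ δ) = [ (λ w → inj₂ (w ↑ˡ f)) , inj₁ ]′ (splitAt e δ)

  exchange-involutive : ∀ s → exchange (exchange s) ≡ s
  exchange-involutive (inj₁ a) rewrite splitAt-↑ʳ e f a = refl
  exchange-involutive (inj₂ δ) with splitAt e δ in eq
  ... | inj₁ w rewrite splitAt-↑ˡ e w f = cong inj₂ (splitAt⁻¹-↑ˡ eq)
  ... | inj₂ a = cong inj₂ (splitAt⁻¹-↑ʳ eq)

  exchange-injective : Injective _≡_ _≡_ exchange
  exchange-injective eq =
    trans (sym (exchange-involutive _)) (trans (cong exchange eq) (exchange-involutive _))

  -- Rows and columns in one formula, with positions given by fixed points and by differences y - x:
  -- row x arises from `u = c`, column y from `u = b`.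
  line : (Fin (e + f) → Fin (e + f)) → Fin (e + f) → Fin f ⊎ Fin (e + f) → Fin f ⊎ Fin (e + f)
  line u x = map-⊎ id (λ δ → x ⊕ u δ) ∘ exchange

  line-injective : ∀ {u} → Injective _≡_ _≡_ u → ∀ x → Injective _≡_ _≡_ (line u x)
  line-injective u-inj x eq =
    exchange-injective (map-⊎-injective (λ eq′ → u-inj (⊕-cancelˡ x _ _ eq′)) eq)

  line-⊕ : ∀ u x g s → line u (x ⊕ g) s ≡ map-⊎ id (_⊕ g) (line u x s)
  line-⊕ u x g s with exchange s
  ... | inj₁ a = refl
  ... | inj₂ δ = cong inj₂ (⊕-swapʳ x g (u δ))

  infixl 7 _·_
  _·_ : Fin f ⊎ Fin (e + f) → Fin f ⊎ Fin (e + f) → Fin f ⊎ Fin (e + f)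
  inj₁ a · inj₁ a′ = inj₁ (a ⊕ a′)
  inj₂ x · inj₁ a  = line c x (inj₁ a)
  s      · inj₂ y  = line b y (map-⊎ id (y ⊖_) s)

  -- The table is defined through its columns; this is the same table read along rows. On an unmoved
  -- diagonal δ = y - x one has y + b δ = x + δ + b δ = x + c δ, and on a moved one both readings
  -- give the same fixed point.
  row : ∀ x s → inj₂ x · s ≡ line c x (map-⊎ id (_⊖ x) s)
  row x (inj₁ a) = refl
  row x (inj₂ y) with splitAt e (y ⊖ x) in eq
  ... | inj₂ a = refl
  ... | inj₁ w = cong inj₂ (begin
    y ⊕ b δ           ≡⟨ cong (_⊕ b δ) ([x⊖y]⊕y≡x x y) ⟨
    y ⊖ x ⊕ x ⊕ b δ   ≡⟨ cong (λ z → z ⊕ x ⊕ b δ) (splitAt⁻¹-↑ˡ eq) ⟨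
    δ ⊕ x ⊕ b δ       ≡⟨ cong (_⊕ b δ) (⊕-comm δ x) ⟩
    x ⊕ δ ⊕ b δ       ≡⟨ ⊕-swapʳ x δ (b δ) ⟩
    x ⊕ b δ ⊕ δ       ≡⟨ ⊕-assoc x (b δ) δ ⟩
    x ⊕ (b δ ⊕ δ)     ≡⟨ cong (x ⊕_) (c≡b⊕id δ δ-small) ⟨
    x ⊕ c δ           ∎)
    where
    δ = w ↑ˡ f

    1+m≤m+n : ∀ m n → .{{NonZero n}} → suc m ≤ m + n
    1+m≤m+n m (suc n) = subst (suc m ≤_) (sym (+-suc m n)) (s≤s (m≤m+n m n))

    -- Since f is positive, the exempt difference e + f - 1 lies on a moved diagonal, while `δ` is
    -- below e.
    δ-small : suc (toℕ δ) < e + f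
    δ-small = <-≤-trans
      (s<s (subst (_< e) (sym (toℕ-↑ˡ w f)) (toℕ<n w))) (1+m≤m+n e f)

  square : ∀ g → EquivariantLatin {Fin f ⊎ Fin (e + f)} (map-⊎ id (_⊕ g))
  square g = record
    { _·_ = _·_ ; ·-cancelˡ = ·-cancelˡ ; ·-cancelʳ = ·-cancelʳ ; equivariant = equivariant }
    where
    ·-cancelˡ : ∀ s {t u} → s · t ≡ s · u → t ≡ u
    ·-cancelˡ (inj₁ a) {inj₁ _} {inj₁ _} eq = cong inj₁ (⊕-cancelˡ a _ _ (inj₁-injective eq))
    ·-cancelˡ (inj₁ a) {inj₂ _} {inj₂ _} eq = cong inj₂ (⊕-cancelʳ (b (e ↑ʳ a)) _ _ (inj₂-injective eq))
    ·-cancelˡ (inj₂ x) {t} {u} eq = map-⊎-injective (⊖-cancelʳ x)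
      (line-injective c-injective x (trans (sym (row x t)) (trans eq (row x u))))

    ·-cancelʳ : ∀ s {t u} → t · s ≡ u · s → t ≡ u
    ·-cancelʳ (inj₁ a) {inj₁ _} {inj₁ _} eq = cong inj₁ (⊕-cancelʳ a _ _ (inj₁-injective eq))
    ·-cancelʳ (inj₁ a) {inj₂ _} {inj₂ _} eq = cong inj₂ (⊕-cancelʳ (c (e ↑ʳ a)) _ _ (inj₂-injective eq))
    ·-cancelʳ (inj₂ y) {t} {u} eq = map-⊎-injective (⊖-cancelˡ y)
      (line-injective b-injective y (trans (sym (column t)) (trans eq (column u))))
      where
      column : ∀ s → s · inj₂ y ≡ line b y (map-⊎ id (y ⊖_) s)
      column (inj₁ _) = refl
      column (inj₂ _) = refl

    equivariant : ∀ s t → map-⊎ id (_⊕ g) (s · t) ≡ map-⊎ id (_⊕ g) s · map-⊎ id (_⊕ g) t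
    equivariant (inj₁ a) (inj₁ a′) = refl
    equivariant (inj₂ x) (inj₁ a)  = sym (line-⊕ c x g (inj₁ a))
    equivariant (inj₁ a) (inj₂ y)  = sym (line-⊕ b y g (inj₁ a))
    equivariant (inj₂ x) (inj₂ y)  = begin
      map-⊎ id (_⊕ g) (line b y (inj₂ (y ⊖ x)))       ≡⟨ line-⊕ b y g (inj₂ (y ⊖ x)) ⟨
      line b (y ⊕ g) (inj₂ (y ⊖ x))                   ≡⟨ cong (line b (y ⊕ g) ∘ inj₂) ([x⊕g]⊖[y⊕g] y x g) ⟨
      line b (y ⊕ g) (inj₂ ((y ⊕ g) ⊖ (x ⊕ g)))       ∎

-- The square is invariant under all translations, so `g` is free; `shiftSquare` takes g = m on the
-- residues modulo d m, a translation with m cycles of length d.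
prolongedSquare : ∀ {f N} .{{_ : NonZero f}} .{{_ : NonZero N}} → f ≤ N → ∀ g →
                  EquivariantLatin {Fin f ⊎ Fin N} (map-⊎ id (_⊕ g))
prolongedSquare {f} {N} f≤N g = go (N ∸ f) (m∸n+n≡m f≤N) g
  where
  go : ∀ {N} .{{_ : NonZero N}} e → e + f ≡ N → ∀ g → EquivariantLatin {Fin f ⊎ Fin N} (map-⊎ id (_⊕ g))
  go e refl = Prolongation.square e f (nearOrthomorphism (e + f))

-- With the k-th element of the i-th cycle numbered m k + i, shift is the m-th
-- power of a single cycle of length d m.
cycle^m-conjugate-shift : ∀ f m d .{{_ : NonZero d}} .{{_ : NonZero (d * m)}} →
  Conjugate (map-⊎ id (_⊕ residue {d * m} m)) (shift f m d)
cycle^m-conjugate-shift f m d = conjugate-sym record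
  { bijection = ↔-id (Fin f) ⊎-↔ mk↔ₛ′ (λ (i , k) → combine k i)
      (λ z → let k , i = remQuot {d} m z in i , k)
      (combine-remQuot {d} m)
      (λ (i , k) → cong (λ (k , i) → i , k) (remQuot-combine k i))
  ; commute = λ { (inj₁ a) → refl ; (inj₂ (i , k)) → cong inj₂ (combine-⊕ i k) }
  }
  where
  combine-⊕ : ∀ i k → combine (k ⊕ residue 1) i ≡ combine k i ⊕ residue m
  combine-⊕ i k = begin
    combine (k ⊕ residue 1) i                          ≡⟨ residue-toℕ _ ⟨
    residue (toℕ (combine (k ⊕ residue 1) i))          ≡⟨ cong residue (toℕ-combine (k ⊕ residue 1) i) ⟩
    residue (m * toℕ (k ⊕ residue 1) + toℕ i)          ≡⟨ residue-+ _ (toℕ i) ⟩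
    residue (m * toℕ (k ⊕ residue 1)) ⊕ residue (toℕ i)
      ≡⟨ cong (_⊕ residue (toℕ i)) (residue-cong wrap) ⟩
    residue (m * toℕ k + m) ⊕ residue (toℕ i)          ≡⟨ residue-+ (m * toℕ k + m) (toℕ i) ⟨
    residue (m * toℕ k + m + toℕ i)                    ≡⟨ cong residue (arith (m * toℕ k) m (toℕ i)) ⟩
    residue (m * toℕ k + toℕ i + m)                    ≡⟨ residue-+ (m * toℕ k + toℕ i) m ⟩
    residue (m * toℕ k + toℕ i) ⊕ residue m            ≡⟨ cong (λ z → residue z ⊕ residue m) (toℕ-combine k i) ⟨
    residue (toℕ (combine k i)) ⊕ residue m            ≡⟨ cong (_⊕ residue m) (residue-toℕ (combine k i)) ⟩
    combine k i ⊕ residue m                            ∎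
    where
    arith : ∀ a b c → a + b + c ≡ a + c + b
    arith = solve-∀

    toℕ-k⊕1 : toℕ (k ⊕ residue 1) ≡ (toℕ k + 1) % d
    toℕ-k⊕1 = begin
      toℕ (k ⊕ residue 1)                     ≡⟨ cong (λ z → toℕ (z ⊕ residue 1)) (residue-toℕ k) ⟨
      toℕ (residue (toℕ k) ⊕ residue {d} 1)   ≡⟨ cong toℕ (residue-+ {d} (toℕ k) 1) ⟨
      toℕ (residue {d} (toℕ k + 1))           ≡⟨ toℕ-residue {d} (toℕ k + 1) ⟩
      (toℕ k + 1) % d                         ∎

    arith′ : ∀ k m → (k + 1) * m ≡ m * k + m
    arith′ = solve-∀

    -- Multiplication by m turns reduction modulo d into reduction modulo d m.
    wrap : m * toℕ (k ⊕ residue 1) % (d * m) ≡ (m * toℕ k + m) % (d * m)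
    wrap = begin
      m * toℕ (k ⊕ residue 1) % (d * m)    ≡⟨ cong (λ z → m * z % (d * m)) toℕ-k⊕1 ⟩
      m * ((toℕ k + 1) % d) % (d * m)      ≡⟨ cong (_% (d * m)) (*-comm m _) ⟩
      (toℕ k + 1) % d * m % (d * m)        ≡⟨ cong (_% (d * m)) (m%n*o≡m*o%[n*o] (toℕ k + 1) d m) ⟩
      (toℕ k + 1) * m % (d * m) % (d * m)  ≡⟨ m%n%n≡m%n ((toℕ k + 1) * m) (d * m) ⟩
      (toℕ k + 1) * m % (d * m)            ≡⟨ cong (_% (d * m)) (arith′ (toℕ k) m) ⟩
      (m * toℕ k + m) % (d * m)            ∎

shiftSquare : ∀ {f m d} .{{_ : NonZero f}} .{{_ : NonZero m}} .{{_ : NonZero d}} →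
              f ≤ m * d → EquivariantLatin (shift f m d)
shiftSquare {f} {m} {d} f≤md = transfer (cycle^m-conjugate-shift f m d)
  (prolongedSquare (subst (f ≤_) (*-comm m d) f≤md) (residue m))
  where
  instance
    dm-nonZero : NonZero (d * m)
    dm-nonZero = m*n≢0 d m

-- Existence without fixed points

fixedPointFree : ∀ m d .{{_ : NonZero d}} → Conjugate (shift 0 m d) (map₂ (_⊕ residue 1))
fixedPointFree m d = record
  { bijection = mk↔ₛ′ [ (λ ()) , id ]′ inj₂ (λ _ → refl) (λ { (inj₁ ()) ; (inj₂ _) → refl })
  ; commute   = λ { (inj₁ ()) ; (inj₂ _) → refl }
  }

-- The coefficients of 2 x - y add up to 1, so the operation commutes with translations.
-- Distinctness in columns rests on the injectivity of doubling in odd order.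
oddSquare : ∀ h → EquivariantLatin {Fin (suc (h * 2))} (_⊕ residue 1)
oddSquare h = record
  { _·_         = λ x y → x ⊕ x ⊖ y
  ; ·-cancelˡ   = λ x → ⊖-cancelˡ (x ⊕ x)
  ; ·-cancelʳ   = λ y eq → x⊕x-injective h (⊖-cancelʳ y eq)
  ; equivariant = λ x y → let 1# = residue 1 in begin
      x ⊕ x ⊖ y ⊕ 1#                      ≡⟨ ⊕-swapʳ (x ⊕ x) (⊝ y) 1# ⟩
      x ⊕ x ⊕ 1# ⊖ y                      ≡⟨ [x⊕g]⊖[y⊕g] (x ⊕ x ⊕ 1#) y 1# ⟨
      (x ⊕ x ⊕ 1# ⊕ 1#) ⊖ (y ⊕ 1#)        ≡⟨ cong (λ z → z ⊕ 1# ⊖ (y ⊕ 1#)) (⊕-swapʳ x x 1#) ⟩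
      (x ⊕ 1# ⊕ x ⊕ 1#) ⊖ (y ⊕ 1#)        ≡⟨ cong (_⊖ (y ⊕ 1#)) (⊕-assoc (x ⊕ 1#) x 1#) ⟩
      (x ⊕ 1# ⊕ (x ⊕ 1#)) ⊖ (y ⊕ 1#)      ∎
  }

-- For y − x = e p + r with p < 2 and r < e, the entry is (p , x + 2 r + j + e i);
-- in terms of y its second coordinate is y + j + (e i + r) − e p.
evenSquare : ∀ e .{{_ : NonZero (e * 2)}} → EquivariantLatin {Fin 2 × Fin (e * 2)} (map₂ (_⊕ residue 1))
evenSquare e = record
  { _·_ = _·_ ; ·-cancelˡ = ·-cancelˡ ; ·-cancelʳ = ·-cancelʳ ; equivariant = equivariant }
  where
  A′ = Fin 2 × Fin (e * 2)

  symbol : Fin 2 → Fin (e * 2) → Fin 2 → Fin 2 × Fin e → A′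
  symbol i x j (p , r) = p , x ⊕ (combine r j ⊕ residue (e * toℕ i))

  infixl 7 _·_
  _·_ : A′ → A′ → A′
  (i , x) · (j , y) = symbol i x j (unglue e (y ⊖ x))

  column : ∀ i x j y {p r} → (p , r) ≡ unglue e (y ⊖ x) →
           proj₂ (symbol i x j (p , r)) ⊕ residue (e * toℕ p) ≡ y ⊕ residue (toℕ j) ⊕ glue e (i , r)
  column i x j y {p} {r} eq = begin
    x ⊕ (combine r j ⊕ residue ei) ⊕ residue ep
      ≡⟨ cong₂ (λ u v → u ⊕ (v ⊕ residue ei) ⊕ residue ep) (residue-toℕ x) (residue-toℕ (combine r j)) ⟨
    residue X ⊕ (residue (toℕ (combine r j)) ⊕ residue ei) ⊕ residue ep
      ≡⟨ cong (λ z → residue X ⊕ (residue z ⊕ residue ei) ⊕ residue ep) (toℕ-combine r j) ⟩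
    residue X ⊕ (residue (2 * toℕ r + toℕ j) ⊕ residue ei) ⊕ residue ep
      ≡⟨ cong (λ z → residue X ⊕ z ⊕ residue ep) (residue-+ (2 * toℕ r + toℕ j) ei) ⟨
    residue X ⊕ residue (2 * toℕ r + toℕ j + ei) ⊕ residue ep
      ≡⟨ cong (_⊕ residue ep) (residue-+ X _) ⟨
    residue (X + (2 * toℕ r + toℕ j + ei)) ⊕ residue ep
      ≡⟨ residue-+ _ ep ⟨
    residue (X + (2 * toℕ r + toℕ j + ei) + ep)
      ≡⟨ cong residue (arith X (toℕ r) (toℕ j) ei ep) ⟩
    residue ((ep + toℕ r) + X + toℕ j + (ei + toℕ r))
      ≡⟨ residue-+ _ (ei + toℕ r) ⟩
    residue ((ep + toℕ r) + X + toℕ j) ⊕ residue (ei + toℕ r)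
      ≡⟨ cong (_⊕ residue (ei + toℕ r)) (residue-+ _ (toℕ j)) ⟩
    residue ((ep + toℕ r) + X) ⊕ residue (toℕ j) ⊕ residue (ei + toℕ r)
      ≡⟨ cong (λ z → z ⊕ residue (toℕ j) ⊕ residue (ei + toℕ r)) (residue-+ (ep + toℕ r) X) ⟩
    residue (ep + toℕ r) ⊕ residue X ⊕ residue (toℕ j) ⊕ residue (ei + toℕ r)
      ≡⟨ cong₂ (λ u v → residue u ⊕ residue X ⊕ residue (toℕ j) ⊕ residue v) (toℕ-glue e p r) (toℕ-glue e i r) ⟨
    residue (toℕ (glue e (p , r))) ⊕ residue X ⊕ residue (toℕ j) ⊕ residue (toℕ (glue e (i , r)))
      ≡⟨ cong₂ (λ u v → u ⊕ residue X ⊕ residue (toℕ j) ⊕ v) (residue-toℕ _) (residue-toℕ _) ⟩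
    glue e (p , r) ⊕ residue X ⊕ residue (toℕ j) ⊕ glue e (i , r)
      ≡⟨ cong₂ (λ u v → u ⊕ v ⊕ residue (toℕ j) ⊕ glue e (i , r))
           (trans (cong (glue e) eq) (glue-unglue e _)) (residue-toℕ x) ⟩
    y ⊖ x ⊕ x ⊕ residue (toℕ j) ⊕ glue e (i , r)
      ≡⟨ cong (λ z → z ⊕ residue (toℕ j) ⊕ glue e (i , r)) ([x⊖y]⊕y≡x x y) ⟩
    y ⊕ residue (toℕ j) ⊕ glue e (i , r) ∎
    where
    X  = toℕ x
    ei = e * toℕ i
    ep = e * toℕ p
    arith : ∀ X r j ei ep → X + (2 * r + j + ei) + ep ≡ (ep + r) + X + j + (ei + r)
    arith = solve-∀

  -- In row (i , x) the symbol reveals p and 2 r + j, hence r and j, and then y = x + e p + r.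
  ·-cancelˡ : ∀ s {t u} → s · t ≡ s · u → t ≡ u
  ·-cancelˡ (i , x) {j , y} {k , z} eq =
    let r≡ , j≡k = combine-injective _ j _ k (⊕-cancelʳ _ _ _ (⊕-cancelˡ x _ _ (cong proj₂ eq)))
    in  cong₂ _,_ j≡k (⊖-cancelʳ x (unglue-injective e (cong₂ _,_ (cong proj₁ eq) r≡)))

  -- In column (j , y) the symbol reveals p, and then `column` reveals e i + r, hence i and r;
  -- finally x = y - (e p + r).
  ·-cancelʳ : ∀ s {t u} → t · s ≡ u · s → t ≡ u
  ·-cancelʳ (j , y) {i , x} {k , z} eq =
    let p , r  = unglue e (y ⊖ x)
        q , s  = unglue e (y ⊖ z)
        p≡q    = cong proj₁ eq
        ir≡ks  = glue-injective e {i , r} {k , s} (⊕-cancelˡ (y ⊕ residue (toℕ j)) _ _ (begin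
                   y ⊕ residue (toℕ j) ⊕ glue e (i , r)          ≡⟨ column i x j y refl ⟨
                   proj₂ ((i , x) · (j , y)) ⊕ residue (e * toℕ p)
                     ≡⟨ cong₂ (λ u p → proj₂ u ⊕ residue (e * toℕ p)) eq p≡q ⟩
                   proj₂ ((k , z) · (j , y)) ⊕ residue (e * toℕ q) ≡⟨ column k z j y refl ⟩
                   y ⊕ residue (toℕ j) ⊕ glue e (k , s)          ∎))
    in  cong₂ _,_ (cong proj₁ ir≡ks)
          (⊖-cancelˡ y (unglue-injective e (cong₂ _,_ p≡q (cong proj₂ ir≡ks))))

  equivariant : ∀ s t → map₂ (_⊕ residue 1) (s · t) ≡ map₂ (_⊕ residue 1) s · map₂ (_⊕ residue 1) t
  equivariant (i , x) (j , y) = begin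
    map₂ (_⊕ residue 1) (symbol i x j (unglue e (y ⊖ x)))
      ≡⟨ cong (_ ,_) (⊕-swapʳ x _ (residue 1)) ⟩
    symbol i (x ⊕ residue 1) j (unglue e (y ⊖ x))
      ≡⟨ cong (symbol i (x ⊕ residue 1) j ∘ unglue e) ([x⊕g]⊖[y⊕g] y x (residue 1)) ⟨
    symbol i (x ⊕ residue 1) j (unglue e ((y ⊕ residue 1) ⊖ (x ⊕ residue 1))) ∎

pairsOfCycles : ∀ q d .{{_ : NonZero d}} →
  Conjugate {Fin q × (Fin 2 × Fin d)} (map-× id (map₂ (_⊕ residue 1)))
    (map₂ {B = λ (_ : Fin (q * 2)) → Fin d} (_⊕ residue 1))
pairsOfCycles q d = record
  { bijection = mk↔ₛ′
      (λ (u , i , x) → combine u i , x)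
      (λ (v , x) → let u , i = remQuot {q} 2 v in u , i , x)
      (λ (v , x) → cong (_, x) (combine-remQuot {q} 2 v))
      (λ (u , i , x) → cong (λ (u , i) → u , i , x) (remQuot-combine u i))
  ; commute = λ _ → refl
  }

fixedPointFreeSquare : ∀ {m d} .{{_ : NonZero m}} .{{_ : NonZero d}} → 2 ∤ d ⊎ 2 ∣ m →
                       EquivariantLatin (shift 0 m d)
fixedPointFreeSquare {m} {d} cond = transfer (conjugate-sym (fixedPointFree m d)) (go cond (even⊎odd d))
  where
  go : ∀ {m d} .{{_ : NonZero m}} .{{_ : NonZero d}} → 2 ∤ d ⊎ 2 ∣ m →
       (∃ λ h → d ≡ h * 2) ⊎ (∃ λ h → d ≡ suc (h * 2)) →
       EquivariantLatin {Fin m × Fin d} (map₂ (_⊕ residue 1))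
  go {m} _                              (inj₂ (h , refl)) = cyclicSquare m ⊗ oddSquare h
  go (inj₁ 2∤d)                         (inj₁ (e , d≡))   = contradiction (divides e d≡) 2∤d
  go (inj₂ (divides (suc q) refl)) (inj₁ (e , refl)) =
    transfer (pairsOfCycles (suc q) (e * 2)) (cyclicSquare (suc q) ⊗ evenSquare e)

-- Sums over finite index sets

-- If y were missed, punching it out would leave an injection into a set with one element fewer.
injective⇒surjective : {f : Fin n → Fin n} → Injective _≡_ _≡_ f → ∀ y → ∃ λ x → f x ≡ y
injective⇒surjective {suc n} {f} f-inj y with any? (λ x → f x ≟ y)
... | yes x = x
... | no ∄x = contradiction
  (injective⇒≤ {f = λ x → punchOut (λ eq → ∄x (x , sym eq))}
    λ {x} {x′} eq → f-inj (punchOut-injective (λ e → ∄x (x , sym e)) (λ e → ∄x (x′ , sym e)) eq))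
  1+n≰n

sum-injective : (g : Fin n → ℕ) {f : Fin n → Fin n} → Injective _≡_ _≡_ f → sum (g ∘ f) ≡ sum g
sum-injective g {f} f-inj = sym (sum-permute g (mk↔ₛ′ f
  (proj₁ ∘ injective⇒surjective f-inj)
  (proj₂ ∘ injective⇒surjective f-inj)
  (λ x → f-inj (proj₂ (injective⇒surjective f-inj (f x))))))

sum-↑ : ∀ k l (g : Fin (k + l) → ℕ) → sum g ≡ sum (g ∘ (_↑ˡ l)) + sum (g ∘ (k ↑ʳ_))
sum-↑ zero    l g = refl
sum-↑ (suc k) l g = trans (cong (g zero +_) (sum-↑ k l (g ∘ suc))) (sym (+-assoc (g zero) _ _))

∑-combine : ∀ m d (g : Fin (m * d) → ℕ) → ∑[ i < m ] ∑[ k < d ] g (combine i k) ≡ sum g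
∑-combine zero    d g = refl
∑-combine (suc m) d g = trans (cong (sum (g ∘ (_↑ˡ (m * d))) +_) (∑-combine m d (g ∘ (d ↑ʳ_))))
  (sym (sum-↑ d (m * d) g))

-- Flattening the double sum along `remQuot` reduces this to `sum-injective`.
∑∑-injective : (g : Fin m × Fin d → ℕ) {f : Fin m × Fin d → Fin m × Fin d} → Injective _≡_ _≡_ f →
               ∑[ i < m ] ∑[ k < d ] g (f (i , k)) ≡ ∑[ i < m ] ∑[ k < d ] g (i , k)
∑∑-injective {m} {d} g {f} f-inj = begin
  ∑[ i < m ] ∑[ k < d ] g (f (i , k))   ≡⟨ unfold (g ∘ f) ⟩
  sum (g ∘ f ∘ remQuot d)               ≡⟨ sum-cong-≗ {m * d} (λ z → cong g (remQuot-combine′ (f (remQuot d z)))) ⟨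
  sum (g ∘ remQuot d ∘ f′)              ≡⟨ sum-injective (g ∘ remQuot d) f′-inj ⟩
  sum (g ∘ remQuot {m} d)               ≡⟨ unfold g ⟨
  ∑[ i < m ] ∑[ k < d ] g (i , k)       ∎
  where
  remQuot-combine′ : ∀ (s : Fin m × Fin d) → remQuot d (combine (proj₁ s) (proj₂ s)) ≡ s
  remQuot-combine′ (i , k) = remQuot-combine i k

  unfold : (h : Fin m × Fin d → ℕ) → ∑[ i < m ] ∑[ k < d ] h (i , k) ≡ sum (h ∘ remQuot {m} d)
  unfold h = trans
    (sum-cong-≗ {m} λ i → sum-cong-≗ {d} λ k → cong h (sym (remQuot-combine i k)))
    (∑-combine m d (h ∘ remQuot {m} d))

  f′ : Fin (m * d) → Fin (m * d)
  f′ = Inverse.from *↔× ∘ f ∘ Inverse.to (*↔× {m} {d})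

  f′-inj : Injective _≡_ _≡_ f′
  f′-inj eq = Injection.injective (↔⇒↣ (*↔× {m} {d})) (f-inj (Injection.injective (↔⇒↣ (↔-sym *↔×)) eq))

∑-const : ∀ m c → ∑[ i < m ] c ≡ m * c
∑-const zero    c = refl
∑-const (suc m) c = cong (c +_) (∑-const m c)

∑-cong-% : ∀ d .{{_ : NonZero d}} {n} {f g : Fin n → ℕ} → (∀ i → f i % d ≡ g i % d) → sum f % d ≡ sum g % d
∑-cong-% d {zero}          eq = refl
∑-cong-% d {suc n} {f} {g} eq = begin
  (f zero + sum (f ∘ suc)) % d              ≡⟨ %-distribˡ-+ (f zero) _ d ⟩
  (f zero % d + sum (f ∘ suc) % d) % d      ≡⟨ cong₂ (λ u v → (u + v) % d) (eq zero) (∑-cong-% d (eq ∘ suc)) ⟩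
  (g zero % d + sum (g ∘ suc) % d) % d      ≡⟨ %-distribˡ-+ (g zero) _ d ⟨
  (g zero + sum (g ∘ suc)) % d              ∎

-- The triangular number n (n - 1) / 2, stated free of subtraction and division.
gauss : ∀ n → (∑[ k < n ] toℕ k) * 2 + n ≡ n * n
gauss zero    = refl
gauss (suc n) = begin
  (∑[ k < n ] suc (toℕ k)) * 2 + suc n      ≡⟨ cong (λ z → z * 2 + suc n) (∑-distrib-+ {n} (λ _ → 1) toℕ) ⟩
  (∑[ k < n ] 1 + ∑[ k < n ] toℕ k) * 2 + suc n
    ≡⟨ cong (λ z → (z + (∑[ k < n ] toℕ k)) * 2 + suc n) (∑-const n 1) ⟩
  (n * 1 + ∑[ k < n ] toℕ k) * 2 + suc n    ≡⟨ arith n (∑[ k < n ] toℕ k) ⟩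
  (∑[ k < n ] toℕ k) * 2 + n + (n * 2 + 1)  ≡⟨ cong (_+ (n * 2 + 1)) (gauss n) ⟩
  n * n + (n * 2 + 1)                       ≡⟨ arith′ n ⟩
  suc n * suc n                             ∎
  where
  arith : ∀ n K → (n * 1 + K) * 2 + suc n ≡ K * 2 + n + (n * 2 + 1)
  arith = solve-∀
  arith′ : ∀ n → n * n + (n * 2 + 1) ≡ suc n * suc n
  arith′ = solve-∀

2∣m*m⇒2∣m : 2 ∣ m * m → 2 ∣ m
2∣m*m⇒2∣m {m} = reduce ∘ euclidsLemma m m (from-yes (prime? 2))

-- Necessity with fixed points

shift-moves : ∀ {f m d} .{{_ : NonZero d}} → 1 < d → ∀ {i k} → shift f m d (inj₂ (i , k)) ≢ inj₂ (i , k)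
shift-moves {d = d} 1<d {k = k} eq = contradiction
  (trans (sym (m<n⇒m%n≡m 1<d)) (trans (residue-injective {d} {1} {0} 1≡0) (m<n⇒m%n≡m (<⇒≤ 1<d))))
  λ ()
  where
  1≡0 : residue {d} 1 ≡ residue 0
  1≡0 = ⊕-identityʳ-unique k (residue 1) (,-injectiveʳ (inj₂-injective eq))

fixed⇒nonZero : ∀ {f m d} .{{_ : NonZero d}} → 1 < d → ∀ {s} → shift f m d s ≡ s → NonZero f
fixed⇒nonZero         1<d {inj₂ _} eq = contradiction eq (shift-moves 1<d)
fixed⇒nonZero {suc _} 1<d {inj₁ _} _  = _

-- A fixed symbol in a fixed column lies in a fixed row, so the fixed columns of
-- a moved row contain moved symbols only.
fixed≤moved : ∀ {f m d} .{{_ : NonZero m}} .{{_ : NonZero d}} → 1 < d →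
              EquivariantLatin (shift f m d) → f ≤ m * d
fixed≤moved {f} {m@(suc _)} {d} 1<d L =
  injective⇒≤ {f = λ a → Inverse.from *↔× (proj₁ (moved a))} λ {a} {b} eq →
  let eq′ = Injection.injective (↔⇒↣ (↔-sym *↔×)) eq
  in  inj₁-injective (·-cancelˡ s₀ (trans (proj₂ (moved a)) (trans (cong inj₂ eq′) (sym (proj₂ (moved b))))))
  where
  open EquivariantLatin L

  s₀ : Fin f ⊎ Fin m × Fin d
  s₀ = inj₂ (zero , residue 0)

  moved : ∀ a → ∃ λ t → s₀ · inj₁ a ≡ inj₂ t
  moved a with s₀ · inj₁ a in eq
  ... | inj₂ t = t , refl
  ... | inj₁ b = contradiction
    (·-cancelʳ (inj₁ a) (trans (sym (equivariant s₀ (inj₁ a))) (trans (cong (shift f m d) eq) (sym eq))))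
    (shift-moves 1<d)

-- Necessity without fixed points: sums of labels

module Labels {m d} .{{_ : NonZero d}} (L : EquivariantLatin {Fin m × Fin d} (map₂ (_⊕ residue 1))) where
  open EquivariantLatin L

  private
    label : Fin m × Fin d → ℕ
    label = toℕ ∘ proj₂

    K : ℕ
    K = ∑[ k < d ] toℕ k

    translate : ℕ → Fin m × Fin d → Fin m × Fin d
    translate k = map₂ (_⊕ residue k)

    translate-suc : ∀ k s → translate (suc k) s ≡ map₂ (_⊕ residue 1) (translate k s)
    translate-suc k (i , x) = cong (i ,_) (begin
      x ⊕ residue (suc k)             ≡⟨ cong (λ z → x ⊕ residue z) (+-comm 1 k) ⟩
      x ⊕ residue (k + 1)             ≡⟨ cong (x ⊕_) (residue-+ k 1) ⟩
      x ⊕ (residue k ⊕ residue 1)     ≡⟨ ⊕-assoc x _ _ ⟨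
      x ⊕ residue k ⊕ residue 1       ∎)

    translate-zero : ∀ s → translate 0 s ≡ s
    translate-zero (i , x) = cong (i ,_) (⊕-identityʳ x)

    -- Powers of an automorphism are automorphisms.
    translate-· : ∀ k s t → translate k (s · t) ≡ translate k s · translate k t
    translate-· zero    s t = trans (translate-zero (s · t)) (sym (cong₂ _·_ (translate-zero s) (translate-zero t)))
    translate-· (suc k) s t = begin
      translate (suc k) (s · t)                             ≡⟨ translate-suc k (s · t) ⟩
      map₂ (_⊕ residue 1) (translate k (s · t))             ≡⟨ cong (map₂ (_⊕ residue 1)) (translate-· k s t) ⟩
      map₂ (_⊕ residue 1) (translate k s · translate k t)   ≡⟨ equivariant _ _ ⟩
      map₂ (_⊕ residue 1) (translate k s) · map₂ (_⊕ residue 1) (translate k t)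
        ≡⟨ cong₂ _·_ (translate-suc k s) (translate-suc k t) ⟨
      translate (suc k) s · translate (suc k) t             ∎

    label-translate : ∀ k s → label (translate k s) % d ≡ (k + label s) % d
    label-translate k (i , x) = residue-injective {d} (begin
      residue (toℕ (x ⊕ residue k))   ≡⟨ residue-toℕ _ ⟩
      x ⊕ residue k                   ≡⟨ ⊕-comm x _ ⟩
      residue k ⊕ x                   ≡⟨ cong (residue k ⊕_) (residue-toℕ x) ⟨
      residue k ⊕ residue (toℕ x)     ≡⟨ residue-+ k (toℕ x) ⟨
      residue (k + toℕ x)             ∎)

    -- Translation by k carries a cell of column (j , 0) to the cell of row (i , 0) in column (j ,
    -- k), and raises the label by k modulo d. This links row sums to column sums.
    cell : ∀ i j k → translate (toℕ k) ((i , ⊝ k) · (j , residue 0)) ≡ (i , residue 0) · (j , k)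
    cell i j k = trans (translate-· (toℕ k) _ _) (cong₂ _·_
      (cong (i ,_) (trans (cong ((⊝ k) ⊕_) (residue-toℕ k)) (⊕-inverseˡ k)))
      (cong (j ,_) (trans (⊕-identityˡ _) (residue-toℕ k))))

    ∑∑-label : ∑[ i < m ] ∑[ k < d ] label (i , k) ≡ m * K
    ∑∑-label = ∑-const m K

    -- A row contains each symbol once, and each of the labels 0, ..., d - 1 belongs to m symbols.
    row-sum : ∀ i → ∑[ j < m ] ∑[ k < d ] label ((i , residue 0) · (j , k)) ≡ m * K
    row-sum i = trans (∑∑-injective label {λ t → (i , residue 0) · t} (·-cancelˡ _)) ∑∑-label

    -- As (i , k) varies, (i , -k) runs through all rows, so this sums a full column.
    column-sum : ∀ j → ∑[ i < m ] ∑[ k < d ] label ((i , ⊝ k) · (j , residue 0)) ≡ m * K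
    column-sum j = trans (∑∑-injective label {λ (i , k) → (i , ⊝ k) · (j , residue 0)} λ eq →
        let eq′ = ·-cancelʳ _ eq in cong₂ _,_ (cong proj₁ eq′) (⁻¹-injective (cong proj₂ eq′)))
      ∑∑-label

    rows : ∑[ i < m ] ∑[ j < m ] ∑[ k < d ] label ((i , residue 0) · (j , k)) ≡ m * (m * K)
    rows = trans (sum-cong-≗ row-sum) (∑-const m (m * K))

    columns : ∑[ i < m ] ∑[ j < m ] ∑[ k < d ] (toℕ k + label ((i , ⊝ k) · (j , residue 0)))
              ≡ m * (m * K) + m * (m * K)
    columns = begin
      ∑[ i < m ] ∑[ j < m ] ∑[ k < d ] (toℕ k + g i j k)
        ≡⟨ (sum-cong-≗ λ i → sum-cong-≗ λ j → ∑-distrib-+ toℕ (g i j)) ⟩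
      ∑[ i < m ] ∑[ j < m ] (K + ∑[ k < d ] g i j k)
        ≡⟨ (sum-cong-≗ λ i → trans (∑-distrib-+ (λ _ → K) (λ j → ∑[ k < d ] g i j k))
             (cong (_+ (∑[ j < m ] ∑[ k < d ] g i j k)) (∑-const m K))) ⟩
      ∑[ i < m ] (m * K + ∑[ j < m ] ∑[ k < d ] g i j k)
        ≡⟨ ∑-distrib-+ (λ _ → m * K) (λ i → ∑[ j < m ] ∑[ k < d ] g i j k) ⟩
      ∑[ i < m ] (m * K) + ∑[ i < m ] ∑[ j < m ] ∑[ k < d ] g i j k
        ≡⟨ cong₂ _+_ (∑-const m (m * K)) (∑-comm (λ i j → ∑[ k < d ] g i j k)) ⟩
      m * (m * K) + ∑[ j < m ] ∑[ i < m ] ∑[ k < d ] g i j k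
        ≡⟨ cong (m * (m * K) +_) (trans (sum-cong-≗ column-sum) (∑-const m (m * K))) ⟩
      m * (m * K) + m * (m * K) ∎
      where
      g : Fin m → Fin m → Fin d → ℕ
      g i j k = label ((i , ⊝ k) · (j , residue 0))

  -- Let T = m² K. Summed by rows, the labels give T; summed through `cell` by columns, they give T
  -- plus the corrections k, which amount to another T. Hence T ≡ 2 T modulo d.
  d∣m²K : d ∣ m * (m * ∑[ k < d ] toℕ k)
  d∣m²K = m%n≡0⇒n∣m T d (trans (residue-injective {d} {T} {0} T≡0) 0%d≡0)
    where
    T = m * (m * K)

    0%d≡0 : 0 % d ≡ 0
    0%d≡0 = m*n%n≡0 0 d

    T≡T+T : T % d ≡ (T + T) % d
    T≡T+T = begin
      T % d ≡⟨ cong (_% d) rows ⟨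
      (∑[ i < m ] ∑[ j < m ] ∑[ k < d ] label ((i , residue 0) · (j , k))) % d
        ≡⟨ (∑-cong-% d λ i → ∑-cong-% d λ j → ∑-cong-% d λ k →
             trans (cong (λ s → label s % d) (sym (cell i j k)))
             (label-translate (toℕ k) ((i , ⊝ k) · (j , residue 0)))) ⟩
      (∑[ i < m ] ∑[ j < m ] ∑[ k < d ] (toℕ k + label ((i , ⊝ k) · (j , residue 0)))) % d
        ≡⟨ cong (_% d) columns ⟩
      (T + T) % d ∎

    T≡0 : residue {d} T ≡ residue 0
    T≡0 = ⊕-identityʳ-unique (residue T) (residue T)
      (trans (sym (residue-+ T T)) (residue-cong {d} {T + T} {T} (sym T≡T+T)))

-- For d = 2 e the sum K of the labels is 2 e² - e, which is -e modulo 2 e. Divisibility of m² K by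
-- 2 e thus becomes divisibility of e m² by 2 e, so m², and with it m, is even.
oddLength⊎evenCount : .{{_ : NonZero d}} → EquivariantLatin (shift 0 m d) → 2 ∤ d ⊎ 2 ∣ m
oddLength⊎evenCount {d} {m} L with 2 ∣? d
... | no  2∤d              = inj₁ 2∤d
... | yes (divides e refl) = inj₂ (2∣m*m⇒2∣m (*-cancelˡ-∣ e {{m*n≢0⇒m≢0 e {2}}} e*2∣e*[m*m]))
  where
  K = ∑[ k < e * 2 ] toℕ k

  K+e : K + e ≡ e * (e * 2)
  K+e = *-cancelʳ-≡ (K + e) (e * (e * 2)) 2 (begin
    (K + e) * 2           ≡⟨ arith K e ⟩
    K * 2 + e * 2         ≡⟨ gauss (e * 2) ⟩
    e * 2 * (e * 2)       ≡⟨ arith′ e ⟩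
    e * (e * 2) * 2       ∎)
    where
    arith : ∀ K e → (K + e) * 2 ≡ K * 2 + e * 2
    arith = solve-∀
    arith′ : ∀ e → e * 2 * (e * 2) ≡ e * (e * 2) * 2
    arith′ = solve-∀

  e*2∣e*[m*m] : e * 2 ∣ e * (m * m)
  e*2∣e*[m*m] = ∣m+n∣m⇒∣n
    (divides (m * m * e) (begin
      m * (m * K) + e * (m * m)   ≡⟨ arith m K e ⟩
      m * m * (K + e)             ≡⟨ cong (m * m *_) K+e ⟩
      m * m * (e * (e * 2))       ≡⟨ arith′ (m * m) e (e * 2) ⟩
      m * m * e * (e * 2)         ∎))
    (Labels.d∣m²K (transfer (fixedPointFree m (e * 2)) L))
    where
    arith : ∀ m K e → m * (m * K) + e * (m * m) ≡ m * m * (K + e)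
    arith = solve-∀
    arith′ : ∀ a b c → a * (b * c) ≡ a * b * c
    arith′ = solve-∀

-- Assembling the two equivalences

n≤2md⇔f≤md : ∀ f m d → n ≡ f + m * d → n ≤ 2 * m * d ⇔ f ≤ m * d
n≤2md⇔f≤md f m d refl = mk⇔
  (λ le → +-cancelʳ-≤ (m * d) f (m * d) (subst (f + m * d ≤_) (arith m d) le))
  (λ le → subst (f + m * d ≤_) (sym (arith m d)) (+-monoˡ-≤ (m * d) le))
  where
  arith : ∀ m d → 2 * m * d ≡ m * d + m * d
  arith = solve-∀

-- As m is positive, there is a nontrivial cycle from which to read off d.
cycleLength>1 : (α : Permutation′ n) → m ≥ 1 → HasPreciselyNontrivialCycles α m →
                (∀ (C : Subset n) → IsNontrivialCycle α C → cycleLength C ≡ d) → 1 < d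
cycleLength>1 α _ (C ∷ _ , _ , complete) length≡d =
  let C-nontrivial = Equivalence.to (complete C) (here refl)
  in  subst (1 <_) (length≡d C C-nontrivial) (proj₂ C-nontrivial)

theorem5p2 : (n m d : ℕ) → n ≥ 1 → m ≥ 1 →
    (α : Permutation′ n) →
    HasPreciselyNontrivialCycles α m →
    (∀ (C : Subset n) → IsNontrivialCycle α C → cycleLength C ≡ d) →
    (HasFixedPoint α → (α ∈ Aut n ⇔ n ≤ 2 * m * d))
    × (¬ HasFixedPoint α → (α ∈ Aut n ⇔ (2 ∤ d ⊎ 2 ∣ m)))
theorem5p2 n m d n≥1 m≥1 α cycles length≡d = withFixedPoint , withoutFixedPoint f φ
  where
  1<d = cycleLength>1 α m≥1 cycles length≡d

  instance
    m-nonZero : NonZero m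
    m-nonZero = >-nonZero m≥1
    d-nonZero : NonZero d
    d-nonZero = >-nonZero (<⇒≤ 1<d)

  f = proj₁ (decomposition 1<d α cycles length≡d)
  φ = proj₂ (decomposition 1<d α cycles length≡d)

  latin⇔ : ∀ {f} → Conjugate (shift f m d) (α ⟨$⟩ʳ_) → α ∈ Aut n ⇔ EquivariantLatin (shift f m d)
  latin⇔ φ = mk⇔ (transfer (conjugate-sym φ) ∘ ∈Aut⇒equivariantLatin α)
                 (equivariantLatin⇒∈Aut α ∘ transfer φ)

  n≡f+md : n ≡ f + m * d
  -- The bijection underlying `φ` counts the points.
  n≡f+md = sym (↔⇒≡ (Conjugate.bijection φ ↔-∘ ((↔-id _ ⊎-↔ *↔×) ↔-∘ +↔⊎)))

  withFixedPoint : HasFixedPoint α → (α ∈ Aut n ⇔ n ≤ 2 * m * d)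
  withFixedPoint fix = mk⇔
    (Equivalence.from (n≤2md⇔f≤md f m d n≡f+md) ∘ fixed≤moved 1<d ∘ Equivalence.to (latin⇔ φ))
    (Equivalence.from (latin⇔ φ) ∘ shiftSquare ∘ Equivalence.to (n≤2md⇔f≤md f m d n≡f+md))
    where
    instance
      f-nonZero : NonZero f
      f-nonZero = let x , αx≡x = fix in fixed⇒nonZero 1<d
        (trans (sym (Conjugate.commute (conjugate-sym φ) x)) (cong (Conjugate.from φ) αx≡x))

  -- Here `f` and `φ` are arguments, so that `f` can be split into cases; a positive `f` would
  -- provide a fixed point of α.
  withoutFixedPoint : ∀ f → Conjugate (shift f m d) (α ⟨$⟩ʳ_) →
                      ¬ HasFixedPoint α → (α ∈ Aut n ⇔ (2 ∤ d ⊎ 2 ∣ m))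
  withoutFixedPoint (suc _) φ ∄fix = contradiction
    (Conjugate.to φ (inj₁ zero) , sym (Conjugate.commute φ (inj₁ zero))) ∄fix
  withoutFixedPoint zero φ _ = mk⇔
    (oddLength⊎evenCount ∘ Equivalence.to (latin⇔ φ))
    (Equivalence.from (latin⇔ φ) ∘ fixedPointFreeSquare)
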